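{- Let $l\ge 1$ and $p\ge 2l+2$ be integers. In the $p$-round two-party communication model with a single output pass, Sliding-$l^{\text{th}}$-Smallest on inputs of length $N$ with values in $[0,R]$ can be solved using $\widetilde{O}\big(p\,l^2\,N^{1/(p-2l-1)}\big)$ bits of communication, where $\widetilde O$ hides factors polylogarithmic in $N$ and $R$ (the bound holds for every window size $K$).
   Context: Problem. The input is an array $A_0,\dots,A_{N-1}$ of integers in $[0,R]$ together with a window size $K\le N$ (with $l\le K$). Sliding-$l^{\text{th}}$-Smallest asks for, for every $i\in\{0,\dots,N-K\}$, the value of the $l$-th smallest element (counted with multiplicity) among $A_i,\dots,A_{i+K-1}$. Two-party communication model. Both parties know $N,K,R$. Alice holds the first half of the array and Bob holds the second half. They alternately send messages, Alice first; each message is one round, and there are $p$ rounds. The answers for all $N-K+1$ windows must be written to a shared write-only output stream; at any of its turns a party may write any number of answers (some are written by Alice, some by Bob), and neither party can read the output stream or the current position in it. Every answer is written exactly once. A single output pass means that the answers are written in the order of increasing window index $i=0,1,\dots,N-K$. The communication cost is the total number of bits in the messages. -}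

module Defs where

open import Data.Bool.Base using (Bool)
open import Data.Fin.Base using (Fin)
open import Data.Fin.Properties using (≤-decTotalOrder)
open import Data.List.Base
  using (List; []; _∷_; _∷ʳ_; take; drop; head; map; concatMap; length; sum; upTo)
open import Data.List.Sort using (sort)
open import Data.Maybe.Base using (Maybe; just)
open import Data.Nat.Base using (ℕ; zero; suc; _+_; _*_; _∸_; _^_; _≤_; ⌊_/2⌋)
open import Data.Nat.Logarithm using (⌈log₂_⌉)
open import Data.Vec.Base using (Vec; toList)
open import Relation.Binary.PropositionalEquality.Core using (_≡_)

-- The integers in [0,R].
Value : ℕ → Set
Value R = Fin (suc R)

------------------------------------------------------------------------
-- Sliding-lᵗʰ-Smallest

-- Ranks count from 1, with multiplicity; the result is  just _  whenever
-- 1 ≤ l ≤ length xs.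
lthSmallest : ∀ {R} → ℕ → List (Value R) → Maybe (Value R)
lthSmallest {R} l xs = head (drop (l ∸ 1) (sort (≤-decTotalOrder (suc R)) xs))

window : ∀ {R N} → Vec (Value R) N → ℕ → ℕ → List (Value R)
window A K i = take K (drop i (toList A))

answers : ∀ {R N} → ℕ → ℕ → Vec (Value R) N → List (Maybe (Value R))
answers {N = N} l K A =
  map (λ i → lthSmallest l (window A K i)) (upTo (suc (N ∸ K)))

------------------------------------------------------------------------
-- Two-party protocols with a write-only output stream

Message : Set
Message = List Bool

-- In one turn a party appends any number of answers to the output stream
-- and sends one message.
record Turn (V : Set) : Set where
  constructor turn
  field
    message : Message
    written : List V

open Turn public

-- A turn depends only on the party's own half of the array and on the
-- messages sent so far (oldest first), hence not on the output stream.
Strategy : Set → Set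
Strategy V = List V → List Message → Turn V

record Protocol (V : Set) : Set where
  field
    alice bob : Strategy V

module _ {V : Set} where

  -- The first argument is the number of rounds left; the first of the two
  -- behaviours is that of the party whose turn it is.
  play : ℕ → (List Message → Turn V) → (List Message → Turn V) →
         List Message → List (Turn V)
  play zero    f g sent = []
  play (suc n) f g sent = f sent ∷ play n g f (sent ∷ʳ message (f sent))

  run : ∀ {N} → Protocol V → ℕ → Vec V N → List (Turn V)
  run {N} P p A = play p (alice (take ⌊ N /2⌋ (toList A)))
                         (bob   (drop ⌊ N /2⌋ (toList A))) []
    where open Protocol P

  output : ∀ {N} → Protocol V → ℕ → Vec V N → List V
  output P p A = concatMap written (run P p A)

  cost : ∀ {N} → Protocol V → ℕ → Vec V N → ℕ
  cost P p A = sum (map (λ t → length (message t)) (run P p A))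

-- Every answer is written exactly once, and in the order of increasing
-- window index (a single output pass).
SolvesInSingleOutputPass :
  ∀ {R} → Protocol (Value R) → (p l N K : ℕ) → Set
SolvesInSingleOutputPass {R} P p l N K =
  (A : Vec (Value R) N) → map just (output P p A) ≡ answers l K A

------------------------------------------------------------------------
-- The form of the bound

-- c ≤ m · N^(1/r) for r ≥ 1, with both sides raised to the r-th power.
_≤_·_^1/_ : ℕ → ℕ → ℕ → ℕ → Set
c ≤ m · N ^1/ r = c ^ r ≤ m ^ r * N

-- The shift by 2 keeps both logarithms positive.
polylog : (d N R : ℕ) → ℕ
polylog d N R = (⌈log₂ (2 + N) ⌉ * ⌈log₂ (2 + R) ⌉) ^ d

{-# OPTIONS --safe #-}
module Submission where

-- Write a_k(i) and b_k(i) for the k-th smallest element (k = 0, 1, …) of Alice's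
-- and Bob's parts of window i.  Among the windows meeting both halves Alice's
-- part shrinks and Bob's grows with i, so a_k increases and b_k decreases.
-- Hence for each j < 2l - 1 the predicate b_⌊j/2⌋(i) ≤ a_{l-1-⌈j/2⌉}(i) is
-- monotone in i.  If c is the first j at which it fails for window i, the
-- answer is a_{l-1-c/2}(i) for even c and b_{(c-1)/2}(i) for odd c.  As c
-- increases with i, the answers fall into 2l consecutive blocks that Alice and
-- Bob write alternately.
--
-- All 2l - 1 thresholds are found in parallel by an s-ary search with
-- N ≤ s^r ≤ 2^r N, r = p - 2l - 1.  Each message carries the sender's current
-- position for every threshold and its values at the s next probes.  After r
-- messages the positions are exact, and one more round at most brings the turn
-- to Alice, who writes the first block.

open import Defs
open import Data.Bool.Base using (Bool; true; false; if_then_else_; not; T)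
open import Data.Fin.Base using (toℕ; zero)
open import Data.Fin.Properties using (≤-decTotalOrder; toℕ≤pred[n]; toℕ-injective)
open import Data.List.Base
  using (List; []; _∷_; _++_; _∷ʳ_; take; drop; head; last; length; filter; map; concat; concatMap; applyUpTo; upTo)
open import Data.List.Properties
open import Data.List.Relation.Binary.Permutation.Propositional.Properties using (filter-↭; ↭-length)
open import Data.List.Relation.Binary.Sublist.Propositional using (_⊆_; ⊆-reflexive; ⊆-trans)
open import Data.List.Relation.Binary.Sublist.Propositional.Properties
  using (filter⁺; length-mono-≤; take⁺; drop⁺-≥; take-⊆)
open import Data.List.Relation.Unary.All as All using (All; []; _∷_)
import Data.List.Relation.Unary.All.Properties as All
open import Data.List.Relation.Unary.AllPairs using (AllPairs; []; _∷_)
import Data.List.Relation.Unary.AllPairs.Properties as AllPairs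
open import Data.List.Relation.Unary.Linked.Properties using (Linked⇒AllPairs)
import Data.List.Sort
open import Data.Maybe.Base using (Maybe; just; nothing; maybe′; fromMaybe)
open import Data.Nat.Base
open import Data.Nat.Induction using (<-wellFounded)
open import Data.Nat.ListAction using (sum)
open import Data.Nat.Logarithm using (⌈log₂_⌉)
open import Data.Nat.Logarithm.Core using (⌈log2⌉)
open import Data.Nat.Properties hiding (≤-decTotalOrder)
open import Data.Nat.Solver using (module +-*-Solver)
open import Data.Product.Base using (_×_; _,_; Σ-syntax; ∃-syntax; proj₁; proj₂)
open import Data.Sum.Base using (_⊎_; inj₁; inj₂)
open import Data.Vec.Base using (Vec; toList)
open import Data.Vec.Properties using (length-toList)
open import Function.Base using (_∘_; id; case_of_)
open import Induction.WellFounded using (Acc; acc)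
open import Relation.Binary.Definitions using (tri<; tri≈; tri>)
open import Relation.Binary.PropositionalEquality
open import Relation.Nullary

-- Order statistics characterised by counting.

module _ {R : ℕ} where

  -- `nothing` sits above every value, so a part too short to have the required element compares as
  -- infinity.
  rank : Maybe (Value R) → ℕ
  rank = maybe′ toℕ (suc R)

  rank≤ : ∀ x → rank x ≤ suc R
  rank≤ (just x) = m≤n⇒m≤1+n (toℕ≤pred[n] x)
  rank≤ nothing  = ≤-refl

  rank-injective : ∀ x y → rank x ≡ rank y → x ≡ y
  rank-injective (just x) (just y) eq = cong just (toℕ-injective eq)
  rank-injective (just x) nothing  eq = contradiction eq (<⇒≢ (s≤s (toℕ≤pred[n] x)))
  rank-injective nothing  (just y) eq = contradiction (sym eq) (<⇒≢ (s≤s (toℕ≤pred[n] y)))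
  rank-injective nothing  nothing  eq = refl

  just-fromMaybe : ∀ {d} (x : Maybe (Value R)) → rank x < suc R → just (fromMaybe d x) ≡ x
  just-fromMaybe (just x) _  = refl
  just-fromMaybe nothing  lt = contradiction lt (<-irrefl refl)

  below : ℕ → List (Value R) → ℕ
  below v xs = length (filter (λ x → toℕ x <? v) xs)

  private
    Ascending : List (Value R) → Set
    Ascending = AllPairs (λ x y → toℕ x ≤ toℕ y)

    below-accept : ∀ {v z} zs → toℕ z < v → below v (z ∷ zs) ≡ suc (below v zs)
    below-accept {v} zs z<v = cong length (filter-accept (λ x → toℕ x <? v) z<v)

    below-none : ∀ {v zs} → All (λ x → v ≤ toℕ x) zs → below v zs ≡ 0
    below-none {v} v≤zs = cong length (filter-none (λ x → toℕ x <? v) (All.map ≤⇒≯ v≤zs))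

    nth<⇒<below : ∀ {v} zs k → Ascending zs → v ≤ suc R →
                  rank (head (drop k zs)) < v → k < below v zs
    nth<⇒<below []       zero    _ v≤ lt = contradiction (≤-trans lt v≤) (<-irrefl refl)
    nth<⇒<below []       (suc k) _ v≤ lt = contradiction (≤-trans lt v≤) (<-irrefl refl)
    nth<⇒<below (z ∷ zs) zero    _ v≤ lt = subst (0 <_) (sym (below-accept zs lt)) z<s
    nth<⇒<below {v} (z ∷ zs) (suc k) (z≤ ∷ asc) v≤ lt with nth<⇒<below zs k asc v≤ lt | toℕ z <? v
    ... | k<  | yes z<v = subst (suc k <_) (sym (below-accept zs z<v)) (s≤s k<)
    ... | k<  | no z≮v  =
      contradiction (subst (k <_) (below-none (All.map (≤-trans (≮⇒≥ z≮v)) z≤)) k<) λ ()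

    <below⇒nth< : ∀ {v} zs k → Ascending zs → k < below v zs → rank (head (drop k zs)) < v
    <below⇒nth< {v} (z ∷ zs) k (z≤ ∷ asc) lt with toℕ z <? v
    <below⇒nth< (z ∷ zs) zero    (z≤ ∷ asc) lt | yes z<v = z<v
    <below⇒nth< (z ∷ zs) (suc k) (z≤ ∷ asc) lt | yes z<v =
      <below⇒nth< zs k asc (s≤s⁻¹ (subst (suc k <_) (below-accept zs z<v) lt))
    <below⇒nth< (z ∷ zs) k       (z≤ ∷ asc) lt | no z≮v =
      contradiction
        (subst (k <_) (below-none (≮⇒≥ z≮v ∷ All.map (≤-trans (≮⇒≥ z≮v)) z≤)) lt) λ ()

  open Data.List.Sort (≤-decTotalOrder (suc R)) using (sort; sort-↭; sort-↗)

  private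
    sort-ascending : ∀ xs → Ascending (sort xs)
    sort-ascending xs = Linked⇒AllPairs ≤-trans (sort-↗ xs)

    below-sort : ∀ v xs → below v (sort xs) ≡ below v xs
    below-sort v xs = ↭-length (filter-↭ (λ x → toℕ x <? v) (sort-↭ xs))

  -- Counts ranks from 0; a missing element has rank R + 1.
  orderStat : ℕ → List (Value R) → ℕ
  orderStat k xs = rank (lthSmallest (suc k) xs)

  -- With the converse that follows, comparisons of order statistics become counts. The bound on `v`
  -- excludes a missing element, of rank R + 1, lying under `v` without being counted.
  orderStat<⇒<below : ∀ {v} k xs → v ≤ suc R → orderStat k xs < v → k < below v xs
  orderStat<⇒<below {v} k xs v≤ lt =
    subst (k <_) (below-sort v xs) (nth<⇒<below (sort xs) k (sort-ascending xs) v≤ lt)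

  <below⇒orderStat< : ∀ {v} k xs → k < below v xs → orderStat k xs < v
  <below⇒orderStat< {v} k xs lt =
    <below⇒nth< (sort xs) k (sort-ascending xs) (subst (k <_) (sym (below-sort v xs)) lt)

  ≤orderStat⇒below≤ : ∀ {v} k xs → v ≤ orderStat k xs → below v xs ≤ k
  ≤orderStat⇒below≤ k xs v≤ = ≮⇒≥ (≤⇒≯ v≤ ∘ <below⇒orderStat< k xs)

  -- Take v = `orderStat k ys`: if `xs` had more than k elements under v, so would `ys`, and v would
  -- be smaller than itself.
  orderStat-antitone : ∀ k {xs ys} → xs ⊆ ys → orderStat k ys ≤ orderStat k xs
  orderStat-antitone k {xs} {ys} xs⊆ys = ≮⇒≥ λ lt →
    <-irrefl refl (<below⇒orderStat< k ys
      (<-≤-trans (orderStat<⇒<below k xs (rank≤ (lthSmallest (suc k) ys)) lt)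
                 (length-mono-≤ (filter⁺ _ _ (λ { refl → id }) xs⊆ys))))

  orderStat-finite : ∀ k xs → k < length xs → orderStat k xs < suc R
  orderStat-finite k xs k< = <below⇒orderStat< k xs
    (subst (k <_) (sym (cong length (filter-all _ (All.universal (s≤s ∘ toℕ≤pred[n]) xs)))) k<)

  below-++ : ∀ v xs ys → below v (xs ++ ys) ≡ below v xs + below v ys
  below-++ v xs ys = trans (cong length (filter-++ _ xs ys)) (length-++ (filter _ xs))

  -- The element v of rank k in `xs` lies between those of ranks q - 1 and q in `ys`, so at most k +
  -- q elements are below v and, if v ≤ R, at least k + q + 1 are below v + 1. Only the counts of
  -- `zs` enter, so the two halves can exchange roles.
  orderStat-merge : ∀ k q xs ys zs → (∀ v → below v zs ≡ below v xs + below v ys) →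
                    orderStat k xs ≤ orderStat q ys →
                    (∀ q′ → q ≡ suc q′ → orderStat q′ ys ≤ orderStat k xs) →
                    orderStat (k + q) zs ≡ orderStat k xs
  orderStat-merge k q xs ys zs split v≤ ≤v = ≤-antisym upper lower
    where
    v = orderStat k xs
    lower : v ≤ orderStat (k + q) zs
    lower = ≮⇒≥ λ lt → <⇒≱ (orderStat<⇒<below (k + q) zs (rank≤ (lthSmallest (suc k) xs)) lt)
      (subst (_≤ k + q) (sym (split v))
        (+-mono-≤ (≤orderStat⇒below≤ k xs ≤-refl) (≤orderStat⇒below≤ q ys v≤)))
    q≤ : ∀ q → (∀ q′ → q ≡ suc q′ → orderStat q′ ys ≤ v) → suc v ≤ suc R → q ≤ below (suc v) ys
    q≤ zero    _  _  = z≤n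
    q≤ (suc q) ≤v v< = orderStat<⇒<below q ys v< (s≤s (≤v q refl))
    upper : orderStat (k + q) zs ≤ v
    upper with suc v ≤? suc R
    ... | yes v< = s≤s⁻¹ (<below⇒orderStat< (k + q) zs (subst (k + q <_) (sym (split (suc v)))
                     (+-mono-≤ (orderStat<⇒<below k xs v< ≤-refl) (q≤ q ≤v v<))))
    -- Here v = R + 1, the largest rank there is.
    ... | no v≮  = ≤-trans (rank≤ (lthSmallest (suc (k + q)) zs)) (s≤s⁻¹ (≰⇒> v≮))

-- Windows across the midpoint and their crossings.

drop-++ : ∀ {A : Set} i (xs ys : List A) → drop i (xs ++ ys) ≡ drop i xs ++ drop (i ∸ length xs) ys
drop-++ zero    []       ys = refl
drop-++ zero    (x ∷ xs) ys = refl
drop-++ (suc i) []       ys = refl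
drop-++ (suc i) (x ∷ xs) ys = drop-++ i xs ys

take-++ : ∀ {A : Set} i (xs ys : List A) → take i (xs ++ ys) ≡ take i xs ++ take (i ∸ length xs) ys
take-++ zero    []       ys = refl
take-++ zero    (x ∷ xs) ys = refl
take-++ (suc i) []       ys = refl
take-++ (suc i) (x ∷ xs) ys = cong (x ∷_) (take-++ i xs ys)

module Windows {R : ℕ} (h K l′ : ℕ) (l′<K : l′ < K) where

  -- Truncated subtraction covers all positions: the right part is empty while K ≤ h - i, and starts
  -- at offset i - h once the window has left the first half.
  leftPart rightPart : List (Value R) → ℕ → List (Value R)
  leftPart  xs i = take K (drop i xs)
  rightPart ys i = take (K ∸ (h ∸ i)) (drop (i ∸ h) ys)

  -- As j runs from 0 to 2l′, the ranks (`l′ ∸ ⌈ j /2⌉`, `⌊ j /2⌋`) follow a staircase from (l′, 0)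
  -- to (0, l′), lowering Alice's rank and raising Bob's in turn.
  leftStat rightStat : List (Value R) → ℕ → ℕ → Maybe (Value R)
  leftStat  xs j i = lthSmallest (suc (l′ ∸ ⌈ j /2⌉)) (leftPart xs i)
  rightStat ys j i = lthSmallest (suc ⌊ j /2⌋) (rightPart ys i)

  module _ (xs ys : List (Value R)) (|xs|≡h : length xs ≡ h) where

    window-split : ∀ i → take K (drop i (xs ++ ys)) ≡ leftPart xs i ++ rightPart ys i
    window-split i rewrite drop-++ i xs ys | take-++ K (drop i xs) (drop (i ∸ length xs) ys)
                         | length-drop i xs | |xs|≡h = refl

    Crossed : ℕ → ℕ → Set
    Crossed j i = rank (rightStat ys j i) ≤ rank (leftStat xs j i)

    crossed-beyond : ∀ j {i} → h ≤ i → Crossed j i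
    crossed-beyond j {i} h≤i rewrite drop-all i xs (subst (_≤ i) (sym |xs|≡h) h≤i) | take-[] {A = Value R} K =
      ≤-trans (rank≤ (rightStat ys j i)) (≮⇒≥ λ lt → contradiction (orderStat<⇒<below {R} (l′ ∸ ⌈ j /2⌉) [] ≤-refl lt) λ ())

    -- A window inside the first half is never crossed: Bob's rank is R + 1 and Alice's is finite. A
    -- window past that half always is. In between, Alice's part only loses elements and Bob's only
    -- gains them.
    crossed-mono : ∀ j {i i′} → i ≤ i′ → Crossed j i → Crossed j i′
    crossed-mono j {i} {i′} i≤i′ Pi with h ≤? i′ | K ≤? h ∸ i
    ... | yes h≤i′ | _ = crossed-beyond j h≤i′
    ... | no h≰i′ | yes K≤ = contradiction Pi (<⇒≱ (<-≤-trans fin inf))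
      where
      fin : rank (leftStat xs j i) < suc R
      fin = orderStat-finite (l′ ∸ ⌈ j /2⌉) (leftPart xs i)
              (subst (l′ ∸ ⌈ j /2⌉ <_)
                (sym (trans (length-take K (drop i xs)) (m≤n⇒m⊓n≡m
                  (subst (K ≤_) (sym (trans (length-drop i xs) (cong (_∸ i) |xs|≡h))) K≤))))
                (≤-<-trans (m∸n≤m l′ ⌈ j /2⌉) l′<K))
      inf : suc R ≤ rank (rightStat ys j i)
      inf rewrite m≤n⇒m∸n≡0 K≤ =
        ≮⇒≥ λ lt → contradiction (orderStat<⇒<below {R} ⌊ j /2⌋ [] ≤-refl lt) λ ()
    ... | no h≰i′ | no K≰ =
      ≤-trans (orderStat-antitone ⌊ j /2⌋ right⊆)
        (≤-trans Pi (orderStat-antitone (l′ ∸ ⌈ j /2⌉) left⊆))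
      where
      i′<h : i′ < h
      i′<h = ≰⇒> h≰i′
      right⊆ : rightPart ys i ⊆ rightPart ys i′
      right⊆ rewrite m≤n⇒m∸n≡0 (<⇒≤ i′<h) | m≤n⇒m∸n≡0 (≤-trans i≤i′ (<⇒≤ i′<h)) =
        take⁺ (∸-monoʳ-≤ K (∸-monoʳ-≤ h i≤i′))
      left⊆ : leftPart xs i′ ⊆ leftPart xs i
      left⊆ = ⊆-trans (take-⊆ K (drop i′ xs)) (⊆-trans (drop⁺-≥ i≤i′)
        (⊆-reflexive (sym (take-all K (drop i xs)
          (subst (_≤ K) (sym (trans (length-drop i xs) (cong (_∸ i) |xs|≡h))) (<⇒≤ (≰⇒> K≰)))))))

    module _ (i : ℕ) where
      private
        L = leftPart xs i
        M = rightPart ys i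
        W = take K (drop i (xs ++ ys))

        split : ∀ v → below v W ≡ below v L + below v M
        split v = trans (cong (below v) (window-split i)) (below-++ v L M)

      -- Crossing at 2q - 1 and failing at 2q puts Alice's element of rank l′ - q between Bob's of
      -- ranks q - 1 and q, so its rank in the window is (l′ - q) + q.
      stat-even : ∀ q → q ≤ l′ → (∀ j → q + q ≡ suc j → Crossed j i) → ¬ Crossed (q + q) i →
                  rank (leftStat xs (q + q) i) ≡ orderStat l′ W
      stat-even q q≤ pre post
        rewrite sym (n≡⌊n+n/2⌋ q) | sym (n≡⌈n+n/2⌉ q) =
        sym (trans (cong (λ k → orderStat k W) (sym (m∸n+n≡m q≤)))
          (orderStat-merge (l′ ∸ q) q L M W split (≰⇒≥ post) (prev q pre)))
        where
        prev : ∀ q → (∀ j → q + q ≡ suc j → Crossed j i) →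
               ∀ q′ → q ≡ suc q′ → orderStat q′ M ≤ orderStat (l′ ∸ q) L
        prev q pre q′ refl = subst₂ (λ a b → orderStat a M ≤ orderStat (l′ ∸ suc b) L)
          (sym (n≡⌈n+n/2⌉ q′)) (sym (n≡⌊n+n/2⌋ q′)) (pre (suc (q′ + q′)) (cong suc (+-suc q′ q′)))

      -- The roles are exchanged: Bob's element of rank q lies between Alice's of ranks l′ - q - 1
      -- and l′ - q. For q = l′ Alice has no lower neighbour, hence the condition `q < l′` in the
      -- last hypothesis.
      stat-odd : ∀ q → q ≤ l′ → Crossed (q + q) i → (q < l′ → ¬ Crossed (suc (q + q)) i) →
                 rank (rightStat ys (suc (q + q)) i) ≡ orderStat l′ W
      stat-odd q q≤ pre post
        rewrite sym (n≡⌊n+n/2⌋ q) | sym (n≡⌈n+n/2⌉ q) =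
        sym (trans (cong (λ k → orderStat k W) (sym (m+[n∸m]≡n q≤)))
          (orderStat-merge q (l′ ∸ q) M L W (λ v → trans (split v) (+-comm (below v L) _)) pre next))
        where
        next : ∀ k → l′ ∸ q ≡ suc k → orderStat k L ≤ orderStat q M
        next k eq = subst (λ a → orderStat a L ≤ orderStat q M)
          (trans (sym (pred[m∸n]≡m∸[1+n] l′ q)) (cong pred eq))
          (≰⇒≥ (post (m∸n≢0⇒n<m λ eq0 → case trans (sym eq0) eq of λ ())))

-- Fixed-width binary numbers and blocks of equal length.

odd : ℕ → Bool
odd zero          = false
odd (suc zero)    = true
odd (suc (suc n)) = odd n

bits : ℕ → ℕ → List Bool
bits zero    n = []
bits (suc w) n = odd n ∷ bits w ⌊ n /2⌋

value : List Bool → ℕ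
value []       = 0
value (b ∷ bs) = (if b then 1 else 0) + (value bs + value bs)

length-bits : ∀ w n → length (bits w n) ≡ w
length-bits zero    n = refl
length-bits (suc w) n = cong suc (length-bits w ⌊ n /2⌋)

odd+2⌊n/2⌋≡n : ∀ n → (if odd n then 1 else 0) + (⌊ n /2⌋ + ⌊ n /2⌋) ≡ n
odd+2⌊n/2⌋≡n zero          = refl
odd+2⌊n/2⌋≡n (suc zero)    = refl
odd+2⌊n/2⌋≡n (suc (suc n)) = begin
  b + suc (k + suc k)     ≡⟨ +-suc b (k + suc k) ⟩
  suc (b + (k + suc k))   ≡⟨ cong (λ x → suc (b + x)) (+-suc k k) ⟩
  suc (b + suc (k + k))   ≡⟨ cong suc (+-suc b (k + k)) ⟩
  suc (suc (b + (k + k))) ≡⟨ cong (suc ∘ suc) (odd+2⌊n/2⌋≡n n) ⟩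
  suc (suc n)             ∎
  where
  open ≡-Reasoning
  b = if odd n then 1 else 0
  k = ⌊ n /2⌋

⌊n/2⌋<2^ : ∀ w n → n < 2 ^ suc w → ⌊ n /2⌋ < 2 ^ w
⌊n/2⌋<2^ w n n< = ≰⇒> λ 2^w≤ → <⇒≱ n< (begin
  2 ^ w + (2 ^ w + 0) ≡⟨ cong (2 ^ w +_) (+-identityʳ (2 ^ w)) ⟩
  2 ^ w + 2 ^ w       ≤⟨ +-mono-≤ 2^w≤ (≤-trans 2^w≤ (⌊n/2⌋≤⌈n/2⌉ n)) ⟩
  ⌊ n /2⌋ + ⌈ n /2⌉   ≡⟨ ⌊n/2⌋+⌈n/2⌉≡n n ⟩
  n                   ∎)
  where open ≤-Reasoning

value-bits : ∀ w n → n < 2 ^ w → value (bits w n) ≡ n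
value-bits zero    zero    n< = refl
value-bits zero    (suc n) (s≤s ())
value-bits (suc w) n       n< rewrite value-bits w ⌊ n /2⌋ (⌊n/2⌋<2^ w n n<) = odd+2⌊n/2⌋≡n n

module _ {A : Set} where

  chunk : ℕ → ℕ → List A → List A
  chunk v k xs = take v (drop (k * v) xs)

  take-length-++ : ∀ (xs ys : List A) → take (length xs) (xs ++ ys) ≡ xs
  take-length-++ []       ys = refl
  take-length-++ (x ∷ xs) ys = cong (x ∷_) (take-length-++ xs ys)

  drop-length-++ : ∀ k (xs ys : List A) → drop (length xs + k) (xs ++ ys) ≡ drop k ys
  drop-length-++ k []       ys = refl
  drop-length-++ k (x ∷ xs) ys = drop-length-++ k xs ys

  chunk-concat : ∀ {v k} (f : ℕ → List A) n → (∀ k → length (f k) ≡ v) → k < n →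
                 chunk v k (concat (applyUpTo f n)) ≡ f k
  chunk-concat {v} {zero} f (suc n) len k<n rewrite sym (len 0) =
    take-length-++ (f 0) _
  chunk-concat {v} {suc k} f (suc n) len (s≤s k<n) = begin
    take v (drop (v + k * v) (f 0 ++ rest))             ≡⟨ cong (λ x → take v (drop (x + k * v) (f 0 ++ rest))) (len 0) ⟨
    take v (drop (length (f 0) + k * v) (f 0 ++ rest))  ≡⟨ cong (take v) (drop-length-++ (k * v) (f 0) rest) ⟩
    take v (drop (k * v) rest)                          ≡⟨ chunk-concat (f ∘ suc) n (len ∘ suc) k<n ⟩
    f (suc k)                                           ∎
    where
    open ≡-Reasoning
    rest = concat (applyUpTo (f ∘ suc) n)

  length-concat : ∀ {v} (f : ℕ → List A) n → (∀ k → length (f k) ≡ v) →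
                  length (concat (applyUpTo f n)) ≡ n * v
  length-concat f zero    len = refl
  length-concat f (suc n) len = trans (length-++ (f 0)) (cong₂ _+_ (len 0) (length-concat (f ∘ suc) n (len ∘ suc)))

  last-∷ʳ : ∀ (xs : List A) x → last (xs ∷ʳ x) ≡ just x
  last-∷ʳ []           x = refl
  last-∷ʳ (_ ∷ [])     x = refl
  last-∷ʳ (_ ∷ y ∷ xs) x = last-∷ʳ (y ∷ xs) x

-- Length of the longest initial run of a predicate.

prefix : (ℕ → Bool) → ℕ → ℕ
prefix f zero    = 0
prefix f (suc n) = if f 0 then suc (prefix (f ∘ suc) n) else 0

prefix≤ : ∀ f n → prefix f n ≤ n
prefix≤ f zero    = z≤n
prefix≤ f (suc n) with f 0
... | true  = s≤s (prefix≤ (f ∘ suc) n)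
... | false = z≤n

<prefix⇒T : ∀ f n {u} → u < prefix f n → T (f u)
<prefix⇒T f (suc n) u< with f 0 in eq
<prefix⇒T f (suc n) {zero}  u<       | true = subst T (sym eq) _
<prefix⇒T f (suc n) {suc u} (s≤s u<) | true = <prefix⇒T (f ∘ suc) n u<

prefix<⇒¬T : ∀ f n → prefix f n < n → ¬ T (f (prefix f n))
prefix<⇒¬T f (suc n) p< with f 0 in eq
... | true  = prefix<⇒¬T (f ∘ suc) n (s≤s⁻¹ p<)
... | false = subst T eq

prefix-mono : ∀ f g n → (∀ {j} → j < n → T (f j) → T (g j)) → prefix f n ≤ prefix g n
prefix-mono f g zero    f⇒g = z≤n
prefix-mono f g (suc n) f⇒g with f 0 | g 0 | f⇒g {0} z<s
... | false | _     | _  = z≤n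
... | true  | true  | _  = s≤s (prefix-mono (f ∘ suc) (g ∘ suc) n (f⇒g ∘ s≤s))
... | true  | false | ff = contradiction _ ff

prefix-cong : ∀ f g n → (∀ {j} → j < n → f j ≡ g j) → prefix f n ≡ prefix g n
prefix-cong f g n f≡g = ≤-antisym
  (prefix-mono f g n λ j< → subst T (f≡g j<))
  (prefix-mono g f n λ j< → subst T (sym (f≡g j<)))

-- Grouping an ordered list by key.

module _ {A : Set} (κ : A → ℕ) where

  private
    bucket : ℕ → List A → List A
    bucket τ = filter (λ x → κ x ≟ τ)

    Ascending : List A → Set
    Ascending = AllPairs (λ x y → κ x ≤ κ y)

    filter-suc : ∀ p {xs} → Ascending xs →
                 filter (λ x → κ x <? suc p) xs ≡ filter (λ x → κ x <? p) xs ++ bucket p xs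
    filter-suc p {[]}     []         = refl
    filter-suc p {x ∷ xs} (x≤ ∷ asc) with <-cmp (κ x) p
    ... | tri< κ< κ≢ _ = begin
      filter (λ x → κ x <? suc p) (x ∷ xs)                    ≡⟨ filter-accept (λ x → κ x <? suc p) (m<n⇒m<1+n κ<) ⟩
      x ∷ filter (λ x → κ x <? suc p) xs                      ≡⟨ cong (x ∷_) (filter-suc p asc) ⟩
      x ∷ filter (λ x → κ x <? p) xs ++ bucket p xs           ≡⟨ cong₂ _++_ (filter-accept (λ x → κ x <? p) κ<) (filter-reject (λ x → κ x ≟ p) κ≢) ⟨
      filter (λ x → κ x <? p) (x ∷ xs) ++ bucket p (x ∷ xs)   ∎
      where open ≡-Reasoning
    ... | tri≈ κ≮ refl _ = begin
      filter (λ x → κ x <? suc p) (x ∷ xs)                    ≡⟨ filter-accept (λ x → κ x <? suc p) ≤-refl ⟩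
      x ∷ filter (λ x → κ x <? suc p) xs                      ≡⟨ cong (x ∷_) (filter-suc p asc) ⟩
      x ∷ filter (λ x → κ x <? p) xs ++ bucket p xs           ≡⟨ cong (λ ys → x ∷ ys ++ bucket p xs) (filter-none (λ x → κ x <? p) (All.map ≤⇒≯ x≤)) ⟩
      x ∷ bucket p xs                                         ≡⟨ cong₂ _++_ (filter-none (λ x → κ x <? p) (κ≮ ∷ All.map ≤⇒≯ x≤)) (filter-accept (λ x → κ x ≟ p) refl) ⟨
      filter (λ x → κ x <? p) (x ∷ xs) ++ bucket p (x ∷ xs)   ∎
      where open ≡-Reasoning
    ... | tri> κ≮ κ≢ κ> = trans
      (filter-none (λ x → κ x <? suc p) (≤⇒≯ κ> ∷ All.map (λ le → ≤⇒≯ (≤-trans κ> le)) x≤))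
      (sym (cong₂ _++_
        (filter-none (λ x → κ x <? p) (κ≮ ∷ All.map (λ le → ≤⇒≯ (<⇒≤ (≤-trans κ> le))) x≤))
        (filter-none (λ x → κ x ≟ p) (κ≢ ∷ All.map (λ le eq → <⇒≢ (≤-trans κ> le) (sym eq)) x≤))))

  -- With ascending keys, each class directly follows the smaller ones. Taking the turn of writing
  -- as key, this is what makes the output a single pass.
  concat-buckets : ∀ p {xs} → Ascending xs → All (λ x → κ x < p) xs →
                   concat (applyUpTo (λ τ → bucket τ xs) p) ≡ xs
  concat-buckets p {xs} asc κ<p = trans (upto p) (filter-all _ κ<p)
    where
    upto : ∀ p → concat (applyUpTo (λ τ → bucket τ xs) p) ≡ filter (λ x → κ x <? p) xs
    upto zero    = sym (filter-none _ (All.universal (λ _ ()) xs))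
    upto (suc p) = begin
      concat (applyUpTo (λ τ → bucket τ xs) (suc p))                    ≡⟨ cong concat (applyUpTo-∷ʳ (λ τ → bucket τ xs) p) ⟨
      concat (applyUpTo (λ τ → bucket τ xs) p ∷ʳ bucket p xs)           ≡⟨ concat-++ (applyUpTo (λ τ → bucket τ xs) p) _ ⟨
      concat (applyUpTo (λ τ → bucket τ xs) p) ++ (bucket p xs ++ [])   ≡⟨ cong₂ _++_ (upto p) (++-identityʳ (bucket p xs)) ⟩
      filter (λ x → κ x <? p) xs ++ bucket p xs                         ≡⟨ filter-suc p asc ⟨
      filter (λ x → κ x <? suc p) xs                                    ∎
      where open ≡-Reasoning

-- Alternating play unrolled by turn number.

alternate : {A : Set} → A → A → ℕ → A
alternate a b zero          = a
alternate a b (suc zero)    = b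
alternate a b (suc (suc n)) = alternate a b n

alternate-double+ : ∀ {A : Set} (a b : A) t n → alternate a b (t + t + n) ≡ alternate a b n
alternate-double+ a b zero    n = refl
alternate-double+ a b (suc t) n rewrite +-suc t t = alternate-double+ a b t n

module _ {V : Set} (f g : List Message → Turn V) where

  history : ℕ → List Message
  history zero    = []
  history (suc τ) = history τ ∷ʳ message (alternate f g τ (history τ))

  length-history : ∀ τ → length (history τ) ≡ τ
  length-history zero    = refl
  length-history (suc τ) = trans (length-++-∷ʳ (history τ)) (cong suc (length-history τ))
    where
    length-++-∷ʳ : ∀ xs {x : Message} → length (xs ∷ʳ x) ≡ suc (length xs)
    length-++-∷ʳ xs = trans (length-++ xs) (+-comm (length xs) 1)

  turns : ℕ → Turn V
  turns τ = alternate f g τ (history τ)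

  play≡turns : ∀ n → play n f g [] ≡ applyUpTo turns n
  play≡turns n = from n 0 turns λ k → cong turns (sym (+-identityʳ k))
    where
    -- The play may start at any turn τ, and `T` need only agree pointwise with the shifted turns,
    -- because `applyUpTo` shifts its function by composing with `suc`.
    from : ∀ n τ (T : ℕ → Turn V) → (∀ k → T k ≡ turns (k + τ)) →
           play n (alternate f g τ) (alternate f g (suc τ)) (history τ) ≡ applyUpTo T n
    from zero    τ T eq = refl
    from (suc n) τ T eq = cong₂ _∷_ (sym (eq 0))
      (from n (suc τ) (T ∘ suc) λ k → trans (eq (suc k)) (cong turns (sym (+-suc k τ))))

-- Bracketing a monotone threshold by s-ary search.

record Party (V : Set) : Set where
  constructor party
  field
    stat    : ℕ → ℕ → Maybe V
    crossed : ℕ → ℕ → Bool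

open Party

-- The first true index is among the `width` candidates from `pos` to `pos + width - 1`, hence the
-- `suc i`. At width 1 it is `pos` itself.
record Bracket (P : ℕ → Bool) (pos width : ℕ) : Set where
  constructor bracket
  field
    before : ∀ {i} → i < pos → ¬ T (P i)
    after  : ∀ {i} → pos + width ≤ suc i → T (P i)

open Bracket

-- The last point of the u-th of the pieces of length g that start at pos.
probe : ℕ → ℕ → ℕ → ℕ
probe pos g u = pred (pos + suc u * g)

T-not : ∀ b → T (not b) → ¬ T b
T-not false _ ()

¬T-not : ∀ b → ¬ T (not b) → T b
¬T-not true  _ = _
¬T-not false h = contradiction _ h

-- A piece whose last point fails can be skipped by monotonicity; the first piece whose last point
-- holds contains the threshold.
refine : ∀ {P pos width} s g → (∀ {i i′} → i ≤ i′ → T (P i) → T (P i′)) → width ≤ s * g →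
         Bracket P pos width → Bracket P (pos + prefix (λ u → not (P (probe pos g u))) s * g) g
refine {P} {pos} {width} s g mono ≤sg br = bracket before′ after′
  where
  missed : ℕ → Bool
  missed u = not (P (probe pos g u))
  before′ : ∀ {i} → i < pos + prefix missed s * g → ¬ T (P i)
  before′ {i} i< with prefix missed s | <prefix⇒T missed s
  ... | zero  | _      = before br (subst (i <_) (+-identityʳ pos) i<)
  ... | suc u | passed = T-not _ (passed {u} ≤-refl) ∘ mono (<⇒≤pred i<)
  after′ : ∀ {i} → pos + prefix missed s * g + g ≤ suc i → T (P i)
  after′ {i} ≤i with m≤n⇒m<n∨m≡n (prefix≤ missed s)
  ... | inj₁ <s = mono (pred-mono-≤ (subst (_≤ suc i) shift ≤i)) (¬T-not _ (prefix<⇒¬T missed s <s))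
    where
    shift : pos + prefix missed s * g + g ≡ pos + suc (prefix missed s) * g
    shift = trans (+-assoc pos _ g) (cong (pos +_) (+-comm _ g))
  -- All s probes failed; the pieces cover the old bracket, which supplies the upper end.
  ... | inj₂ eq = after br (≤-trans (+-monoʳ-≤ pos ≤sg)
                    (≤-trans (m≤m+n (pos + s * g) g) (subst (λ x → pos + x * g + g ≤ suc i) eq ≤i)))

-- The search protocol and its messages.

module ThresholdSearch {R : ℕ} (m s w r n τ₀ : ℕ) where

  private V = Value R

  row : (ℕ → ℕ) → List Bool
  row cell = concat (applyUpTo (λ u → bits w (cell u)) (suc s))

  -- Row j belongs to threshold j: column 0 holds the sender's position, columns 1 to s its values
  -- at the probes, in w bits each.
  encode : (ℕ → ℕ → ℕ) → Message
  encode cell = concat (applyUpTo (λ j → row (cell j)) m)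

  decode : Message → ℕ → ℕ → ℕ
  decode M j u = value (chunk w u (chunk (suc s * w) j M))

  length-row : (cell : ℕ → ℕ) → length (row cell) ≡ suc s * w
  length-row cell = length-concat (λ u → bits w (cell u)) (suc s) (λ u → length-bits w (cell u))

  length-encode : (cell : ℕ → ℕ → ℕ) → length (encode cell) ≡ m * (suc s * w)
  length-encode cell = length-concat (λ j → row (cell j)) m (λ j → length-row (cell j))

  decode-encode : (cell : ℕ → ℕ → ℕ) → ∀ {j u} → j < m → u < suc s → cell j u < 2 ^ w →
                  decode (encode cell) j u ≡ cell j u
  decode-encode cell {j} {u} j<m u≤s fits = begin
    value (chunk w u (chunk (suc s * w) j (encode cell)))
      ≡⟨ cong (value ∘ chunk w u) (chunk-concat (λ j → row (cell j)) m (λ j → length-row (cell j)) j<m) ⟩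
    value (chunk w u (row (cell j)))
      ≡⟨ cong value (chunk-concat (λ u → bits w (cell j u)) (suc s) (λ u → length-bits w (cell j u)) u≤s) ⟩
    value (bits w (cell j u))
      ≡⟨ value-bits w (cell j u) fits ⟩
    cell j u ∎
    where open ≡-Reasoning

  -- The bracket width after τ messages; truncated subtraction keeps it at 1 from the r-th message
  -- on.
  granule : ℕ → ℕ
  granule τ = s ^ (r ∸ τ)

  -- The last message suffices, since it carries the sender's position; the receiver adds its own
  -- values at the same probes, decides the predicate there and skips the missed pieces. Before any
  -- message the search starts at 0.
  position : Party V → List Message → ℕ → ℕ
  position π sent j = maybe′ refined 0 (last sent)
    where
    g = granule (length sent)
    refined : Message → ℕ
    refined M = decode M j 0 + prefix missed s * g
      where
      missed : ℕ → Bool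
      missed u = not (crossed π (rank (stat π j (probe (decode M j 0) g u))) (decode M j (suc u)))

  cells : Party V → List Message → ℕ → ℕ → ℕ
  cells π sent j zero    = position π sent j
  cells π sent j (suc u) =
    rank (stat π j (probe (position π sent j) (granule (suc (length sent))) u))

  phase : (ℕ → ℕ) → ℕ → ℕ
  phase pos i = prefix (λ j → pos j ≤ᵇ i) m

  -- The block of phase c is written at turn τ₀ + c, so nothing is written before
  -- turn τ₀, when the positions may still be inexact.
  deliver : Party V → (ℕ → ℕ) → ℕ → List V
  deliver π φ τ = map (λ i → fromMaybe zero (stat π (φ i) i)) (filter (λ i → τ₀ + φ i ≟ τ) (upTo n))

  takeTurn : Party V → List Message → Turn V
  takeTurn π sent = turn
    (encode (cells π sent))
    (deliver π (phase (position π sent)) (length sent))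

  -- Both decide whether Bob's value is at most Alice's; they differ in which of the two is their
  -- own and which was received.
  aliceParty bobParty : (ℕ → ℕ → Maybe V) → Party V
  aliceParty  stat = party stat (λ own got → got ≤ᵇ own)
  bobParty stat = party stat _≤ᵇ_

  -- Cost and correctness of the protocol.

  module Correct
    (statA statB : ℕ → ℕ → Maybe V)
    where

    P : ℕ → ℕ → Bool
    P j i = rank (statB j i) ≤ᵇ rank (statA j i)

    private
      A = aliceParty statA
      B = bobParty statB
      side = alternate A B
      hist = history (takeTurn A) (takeTurn B)

    alternate-takeTurn : ∀ τ → alternate (takeTurn A) (takeTurn B) τ ≡ takeTurn (side τ)
    alternate-takeTurn zero          = refl
    alternate-takeTurn (suc zero)    = refl
    alternate-takeTurn (suc (suc τ)) = alternate-takeTurn τ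

    length-turn : ∀ τ → length (message (turns (takeTurn A) (takeTurn B) τ)) ≡ m * (suc s * w)
    length-turn τ rewrite alternate-takeTurn τ = length-encode (cells (side τ) (hist τ))

    total-length : ∀ p → sum (map (λ t → length (message t)) (play p (takeTurn A) (takeTurn B) []))
                   ≡ p * (m * (suc s * w))
    total-length p rewrite play≡turns (takeTurn A) (takeTurn B) p = go (turns (takeTurn A) (takeTurn B)) length-turn p
      where
      go : ∀ (T : ℕ → Turn V) → (∀ τ → length (message (T τ)) ≡ m * (suc s * w)) → ∀ p →
           sum (map (λ t → length (message t)) (applyUpTo T p)) ≡ p * (m * (suc s * w))
      go T eq zero    = refl
      go T eq (suc p) = cong₂ _+_ (eq 0) (go (T ∘ suc) (eq ∘ suc) p)

    crossed-side : ∀ τ j i → crossed (side (suc τ)) (rank (stat (side (suc τ)) j i)) (rank (stat (side τ) j i)) ≡ P j i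
    crossed-side zero          j i = refl
    crossed-side (suc zero)    j i = refl
    crossed-side (suc (suc τ)) j i = crossed-side τ j i

    pos : ℕ → ℕ → ℕ
    pos τ = position (side τ) (hist τ)

    order : ℕ → ℕ
    order i = prefix (λ j → P j i) m

    module _ {h : ℕ} .{{_ : NonZero s}}
      (mono : ∀ j {i i′} → i ≤ i′ → T (P j i) → T (P j i′))
      (beyond : ∀ j {i} → h ≤ i → T (P j i))
      (h<s^r : h < s ^ r) (h<2^w : h < 2 ^ w) (R+1<2^w : suc R < 2 ^ w)
      where

      granule-step : ∀ τ → granule τ ≤ s * granule (suc τ)
      granule-step τ = subst (λ k → s ^ (r ∸ τ) ≤ s * s ^ k) (pred[m∸n]≡m∸[1+n] r τ) (step (r ∸ τ))
        where
        step : ∀ k → s ^ k ≤ s * s ^ pred k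
        step zero    = ≤-trans (>-nonZero⁻¹ s) (≤-reflexive (sym (*-identityʳ s)))
        step (suc k) = ≤-refl

      pos-suc : ∀ τ {j} → j < m → pos τ j < 2 ^ w →
                pos (suc τ) j ≡ pos τ j + prefix (λ u → not (P j (probe (pos τ j) (granule (suc τ)) u))) s * granule (suc τ)
      pos-suc τ {j} j<m pos<
        rewrite last-∷ʳ (hist τ) (message (alternate (takeTurn A) (takeTurn B) τ (hist τ)))
              | length-history (takeTurn A) (takeTurn B) (suc τ)
              | alternate-takeTurn τ
              | decode-encode (cells (side τ) (hist τ)) j<m z<s pos<
        = cong (λ k → pos τ j + k * granule (suc τ)) (prefix-cong _ _ s λ {u} u<s → cong not (trans
            (cong (crossed (side (suc τ)) (rank (stat (side (suc τ)) j (probe (pos τ j) (granule (suc τ)) u))))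
              (trans (decode-encode (cells (side τ) (hist τ)) j<m (s≤s u<s) (≤-<-trans (rank≤ (stat (side τ) j _)) R+1<2^w))
                (cong (λ k → rank (stat (side τ) j (probe (pos τ j) (granule (suc k)) u))) (length-history (takeTurn A) (takeTurn B) τ))))
            (crossed-side τ j (probe (pos τ j) (granule (suc τ)) u))))

      pos-bracket : ∀ τ {j} → j < m → Bracket (P j) (pos τ j) (granule τ)
      -- From index s^r - 1 on, i is at least h, since h < s^r.
      pos-bracket zero    {j} j<m = bracket (λ ()) (λ le → beyond j (s≤s⁻¹ (≤-trans h<s^r le)))
      pos-bracket (suc τ) {j} j<m = subst (λ x → Bracket (P j) x (granule (suc τ)))
        -- The predicate fails before the position but holds at h, so the position is at most h and
        -- fits into w bits.
        (sym (pos-suc τ j<m (≤-<-trans (≮⇒≥ λ h< → before br h< (beyond j ≤-refl)) h<2^w)))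
        (refine s (granule (suc τ)) (mono j) (granule-step τ) br)
        where br = pos-bracket τ j<m

      -- After r messages every bracket has width 1, so comparing i with the positions decides each
      -- predicate exactly.
      phase≡order : ∀ τ → r ≤ τ → ∀ i → phase (pos τ) i ≡ order i
      phase≡order τ r≤τ i = ≤-antisym
        (prefix-mono _ _ m λ {j} j<m le → after (br j<m)
          (≤-trans (≤-reflexive (+-comm (pos τ j) 1)) (s≤s (≤ᵇ⇒≤ _ _ le))))
        (prefix-mono _ _ m λ j<m Pji → ≤⇒≤ᵇ (≮⇒≥ λ i< → before (br j<m) i< Pji))
        where
        br : ∀ {j} → j < m → Bracket (P j) (pos τ j) 1
        br {j} j<m = subst (λ k → Bracket (P j) (pos τ j) (s ^ k)) (m≤n⇒m∸n≡0 r≤τ) (pos-bracket τ j<m)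

      order-mono : ∀ {i i′} → i ≤ i′ → order i ≤ order i′
      order-mono i≤i′ = prefix-mono _ _ m λ {j} _ → mono j i≤i′

      module _ (t p : ℕ) (τ₀≡t+t : τ₀ ≡ t + t) (r≤τ₀ : r ≤ τ₀) (τ₀+m<p : τ₀ + m < p)
        (ans : ℕ → Maybe V)
        (reply : ∀ {i} → i < n → just (fromMaybe zero (stat (side (order i)) (order i) i)) ≡ ans i)
        where

        private
          κ : ℕ → ℕ
          κ i = τ₀ + order i

        -- Since τ₀ is even, even blocks fall to Alice and odd blocks to Bob.
        side-κ : ∀ i → side (κ i) ≡ side (order i)
        side-κ i rewrite τ₀≡t+t = alternate-double+ A B t (order i)

        deliver-early : ∀ {X : Set} (f : ℕ → X) (φ : ℕ → ℕ) {τ} → ¬ τ₀ ≤ τ →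
                        map f (filter (λ i → τ₀ + φ i ≟ τ) (upTo n)) ≡ []
        deliver-early f φ {τ} τ₀≰τ = cong (map f) (filter-none (λ i → τ₀ + φ i ≟ τ)
          (All.universal (λ i eq → τ₀≰τ (m+n≤o⇒m≤o τ₀ (≤-reflexive eq))) (upTo n)))

        deliver-correct : ∀ φ τ → (∀ i → φ i ≡ order i) →
                          map just (deliver (side τ) φ τ) ≡ map ans (filter (λ i → κ i ≟ τ) (upTo n))
        deliver-correct φ τ φ≡order = begin
          map just (deliver (side τ) φ τ)
            ≡⟨ map-∘ (filter (λ i → τ₀ + φ i ≟ τ) (upTo n)) ⟨
          map answer (filter (λ i → τ₀ + φ i ≟ τ) (upTo n))
            ≡⟨ cong (map answer) (filter-≐ (λ i → τ₀ + φ i ≟ τ) (λ i → κ i ≟ τ)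
                 ((λ {i} → trans (cong (τ₀ +_) (sym (φ≡order i)))) , (λ {i} → trans (cong (τ₀ +_) (φ≡order i))))
                 (upTo n)) ⟩
          map answer (filter (λ i → κ i ≟ τ) (upTo n))
            ≡⟨ map-cong-local (All.zipWith right
                 (All.all-filter (λ i → κ i ≟ τ) (upTo n) , All.filter⁺ (λ i → κ i ≟ τ) (All.all-upTo n))) ⟩
          map ans (filter (λ i → κ i ≟ τ) (upTo n)) ∎
          where
          open ≡-Reasoning
          answer : ℕ → Maybe V
          answer i = just (fromMaybe zero (stat (side τ) (φ i) i))
          right : ∀ {i} → κ i ≡ τ × i < n → answer i ≡ ans i
          right {i} (refl , i<n) rewrite φ≡order i | side-κ i = reply i<n

        written-turn : ∀ τ → map just (written (turns (takeTurn A) (takeTurn B) τ)) ≡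
                       map ans (filter (λ i → κ i ≟ τ) (upTo n))
        written-turn τ = begin
          map just (written (turns (takeTurn A) (takeTurn B) τ))
            ≡⟨ cong (λ f → map just (written (f (hist τ)))) (alternate-takeTurn τ) ⟩
          map just (deliver (side τ) (phase (pos τ)) (length (hist τ)))
            ≡⟨ cong (map just ∘ deliver (side τ) (phase (pos τ))) (length-history (takeTurn A) (takeTurn B) τ) ⟩
          map just (deliver (side τ) (phase (pos τ)) τ)
            ≡⟨ by-time (τ₀ ≤? τ) ⟩
          map ans (filter (λ i → κ i ≟ τ) (upTo n)) ∎
          where
          open ≡-Reasoning
          by-time : Dec (τ₀ ≤ τ) → map just (deliver (side τ) (phase (pos τ)) τ) ≡
                    map ans (filter (λ i → κ i ≟ τ) (upTo n))
          by-time (yes τ₀≤τ) = deliver-correct (phase (pos τ)) τ (phase≡order τ (≤-trans r≤τ₀ τ₀≤τ))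
          by-time (no τ₀≰τ)  = trans (cong (map just) (deliver-early _ (phase (pos τ)) τ₀≰τ))
                                     (sym (deliver-early ans order τ₀≰τ))

        -- Window i is written at turn `κ i`, which is less than p and nondecreasing in i, so the
        -- turns in order reproduce the windows in order.
        output-correct : map just (concatMap written (play p (takeTurn A) (takeTurn B) [])) ≡ map ans (upTo n)
        output-correct = begin
          map just (concatMap written (play p (takeTurn A) (takeTurn B) []))
            ≡⟨ cong (map just ∘ concatMap written) (play≡turns (takeTurn A) (takeTurn B) p) ⟩
          map just (concatMap written (applyUpTo T′ p))
            ≡⟨ map-concatMap just written (applyUpTo T′ p) ⟩
          concatMap (map just ∘ written) (applyUpTo T′ p)
            ≡⟨ cong concat (map-applyUpTo T′ (map just ∘ written) p) ⟩
          concat (applyUpTo (map just ∘ written ∘ T′) p)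
            ≡⟨ cong concat (applyUpTo-cong written-turn p) ⟩
          concat (applyUpTo (map ans ∘ F) p)
            ≡⟨ cong concat (map-applyUpTo F (map ans) p) ⟨
          concat (map (map ans) (applyUpTo F p))
            ≡⟨ concat-map (applyUpTo F p) ⟩
          map ans (concat (applyUpTo F p))
            ≡⟨ cong (map ans) (concat-buckets κ p
                 (AllPairs.applyUpTo⁺₁ id n (λ i<j _ → +-monoʳ-≤ τ₀ (order-mono (<⇒≤ i<j))))
                 (All.universal (λ i → ≤-<-trans (+-monoʳ-≤ τ₀ (prefix≤ _ m)) τ₀+m<p) (upTo n))) ⟩
          map ans (upTo n) ∎
          where
          open ≡-Reasoning
          T′ = turns (takeTurn A) (takeTurn B)
          F = λ τ → filter (λ i → κ i ≟ τ) (upTo n)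
          applyUpTo-cong : ∀ {X : Set} {f g : ℕ → X} → (∀ k → f k ≡ g k) → ∀ n → applyUpTo f n ≡ applyUpTo g n
          applyUpTo-cong eq zero    = refl
          applyUpTo-cong eq (suc n) = cong₂ _∷_ (eq 0) (applyUpTo-cong (eq ∘ suc) n)

-- Logarithms, integer roots and the cost bound.

n≤2^⌈log₂n⌉ : ∀ n → n ≤ 2 ^ ⌈log₂ n ⌉
n≤2^⌈log₂n⌉ n = go n (<-wellFounded n)
  where
  open ≤-Reasoning
  go : ∀ n (rs : Acc _<_ n) → n ≤ 2 ^ ⌈log2⌉ n rs
  go 0             _        = z≤n
  go 1             _        = ≤-refl
  go (suc (suc n)) (acc rs) = begin
    suc (suc n)                         ≡⟨ cong (suc ∘ suc) (⌊n/2⌋+⌈n/2⌉≡n n) ⟨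
    suc (suc (⌊ n /2⌋ + ⌈ n /2⌉))       ≤⟨ s≤s (s≤s (+-monoˡ-≤ ⌈ n /2⌉ (⌊n/2⌋≤⌈n/2⌉ n))) ⟩
    suc (suc (⌈ n /2⌉ + ⌈ n /2⌉))       ≡⟨ solve 1 (λ k → con 2 :+ (k :+ k) := con 2 :* (con 1 :+ k)) refl ⌈ n /2⌉ ⟩
    2 * suc ⌈ n /2⌉                     ≤⟨ *-monoʳ-≤ 2 (go (suc ⌈ n /2⌉) _) ⟩
    2 * 2 ^ ⌈log2⌉ (suc ⌈ n /2⌉) _      ∎
    where open +-*-Solver

2+N≤2^polylog : ∀ N R → 2 + N ≤ 2 ^ polylog 1 N R
2+N≤2^polylog N R = ≤-trans (n≤2^⌈log₂n⌉ (2 + N)) (^-monoʳ-≤ 2 (≤-trans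
  (m≤m*n ⌈log₂ (2 + N) ⌉ ⌈log₂ (2 + R) ⌉ {{>-nonZero z<s}})
  (≤-reflexive (sym (^-identityʳ (⌈log₂ (2 + N) ⌉ * ⌈log₂ (2 + R) ⌉))))))

2+R≤2^polylog : ∀ N R → 2 + R ≤ 2 ^ polylog 1 N R
2+R≤2^polylog N R = ≤-trans (2+N≤2^polylog R N)
  (≤-reflexive (cong (λ x → 2 ^ (x ^ 1)) (*-comm ⌈log₂ (2 + R) ⌉ ⌈log₂ (2 + N) ⌉)))

[m*n]^k≡m^k*n^k : ∀ m n k → (m * n) ^ k ≡ m ^ k * n ^ k
[m*n]^k≡m^k*n^k m n zero    = refl
[m*n]^k≡m^k*n^k m n (suc k) rewrite [m*n]^k≡m^k*n^k m n k =
  solve 4 (λ m n a b → m :* n :* (a :* b) := m :* a :* (n :* b)) refl m n (m ^ k) (n ^ k)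
  where open +-*-Solver

-- Raise N by one at a time and double s whenever s^r falls short. Then s^r was at most N, which
-- gives the upper bound, and 2^r N ≥ 2N ≥ N + 1 as r ≥ 1.
approxRoot : ∀ r N .{{_ : NonZero r}} .{{_ : NonZero N}} →
             ∃[ s ] (1 ≤ s × N ≤ s ^ r × s ^ r ≤ 2 ^ r * N)
approxRoot r 1 = 1 , ≤-refl , ≤-reflexive (sym (^-zeroˡ r)) ,
  ≤-trans (^-monoˡ-≤ r (s≤s z≤n)) (≤-reflexive (sym (*-identityʳ (2 ^ r))))
approxRoot r (suc N@(suc _)) with approxRoot r N
... | s , 1≤s , N≤ , ≤N with suc N ≤? s ^ r
...   | yes N< = s , 1≤s , N< , ≤-trans ≤N (*-monoʳ-≤ (2 ^ r) (n≤1+n N))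
...   | no N≮  = 2 * s , ≤-trans 1≤s (m≤m+n s (s + 0)) , lower , upper
  where
  open ≤-Reasoning
  lower : suc N ≤ (2 * s) ^ r
  lower = begin
    suc N           ≤⟨ s≤s (m≤m+n N _) ⟩
    suc (N + pred N) ≡⟨ cong suc (+-comm N (pred N)) ⟩
    N + N           ≡⟨ cong (N +_) (+-identityʳ N) ⟨
    2 * N           ≤⟨ *-mono-≤ (≤-trans (≤-reflexive (sym (^-identityʳ 2))) (^-monoʳ-≤ 2 (>-nonZero⁻¹ r))) N≤ ⟩
    2 ^ r * s ^ r   ≡⟨ [m*n]^k≡m^k*n^k 2 s r ⟨
    (2 * s) ^ r     ∎
  upper : (2 * s) ^ r ≤ 2 ^ r * suc N
  upper = begin
    (2 * s) ^ r     ≡⟨ [m*n]^k≡m^k*n^k 2 s r ⟩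
    2 ^ r * s ^ r   ≤⟨ *-monoʳ-≤ (2 ^ r) (<⇒≤ (≰⇒> N≮)) ⟩
    2 ^ r * suc N   ∎

evenOrOdd : ∀ n → ∃[ q ] (n ≡ q + q ⊎ n ≡ suc (q + q))
evenOrOdd zero    = 0 , inj₁ refl
evenOrOdd (suc n) with evenOrOdd n
... | q , inj₁ eq = q , inj₂ (cong suc eq)
... | q , inj₂ eq = suc q , inj₁ (cong suc (trans eq (sym (+-suc q q))))

halve-≤ : ∀ q k → q + q ≤ suc (k + k) → q ≤ k
halve-≤ q k le = ≮⇒≥ λ k<q → <⇒≱ (s≤s le)
  (≤-trans (≤-reflexive (cong suc (sym (+-suc k k)))) (+-mono-≤ k<q k<q))

-- The constant 8 is the product of 2 from `m`, 2 from s + 1 ≤ 2s, and 2 from the rounding of the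
-- r-th root of N.
bound : ∀ p l s m w r N → 1 ≤ s → m ≤ 2 * l ^ 2 → s ^ r ≤ 2 ^ r * N →
        (p * (m * (suc s * w))) ^ r ≤ (8 * w * (p * l ^ 2)) ^ r * N
bound p l s m w r N 1≤s m≤ s^r≤ = begin
  (p * (m * (suc s * w))) ^ r
    ≤⟨ ^-monoˡ-≤ r (*-monoʳ-≤ p (*-mono-≤ m≤ (*-monoˡ-≤ w (≤-trans (≤-reflexive (+-comm 1 s)) (+-monoʳ-≤ s 1≤s))))) ⟩
  (p * (2 * l ^ 2 * ((s + s) * w))) ^ r
    ≡⟨ cong (_^ r) (solve 4 (λ p a s w → p :* (con 2 :* a :* ((s :+ s) :* w)) := con 4 :* w :* (p :* a) :* s) refl p (l ^ 2) s w) ⟩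
  (4 * w * (p * l ^ 2) * s) ^ r
    ≡⟨ [m*n]^k≡m^k*n^k (4 * w * (p * l ^ 2)) s r ⟩
  (4 * w * (p * l ^ 2)) ^ r * s ^ r
    ≤⟨ *-monoʳ-≤ ((4 * w * (p * l ^ 2)) ^ r) s^r≤ ⟩
  (4 * w * (p * l ^ 2)) ^ r * (2 ^ r * N)
    ≡⟨ *-assoc ((4 * w * (p * l ^ 2)) ^ r) (2 ^ r) N ⟨
  (4 * w * (p * l ^ 2)) ^ r * 2 ^ r * N
    ≡⟨ cong (_* N) ([m*n]^k≡m^k*n^k (4 * w * (p * l ^ 2)) 2 r) ⟨
  (4 * w * (p * l ^ 2) * 2) ^ r * N
    ≡⟨ cong (λ x → x ^ r * N) (solve 2 (λ w a → con 4 :* w :* a :* con 2 := con 8 :* w :* a) refl w (p * l ^ 2)) ⟩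
  (8 * w * (p * l ^ 2)) ^ r * N ∎
  where
  open ≤-Reasoning
  open +-*-Solver

1+2k≤2*[1+k]^2 : ∀ l′ → suc (l′ + l′) ≤ 2 * suc l′ ^ 2
1+2k≤2*[1+k]^2 l′ = begin
  suc (l′ + l′)          ≤⟨ n≤1+n _ ⟩
  suc (suc (l′ + l′))    ≡⟨ solve 1 (λ k → con 2 :+ (k :+ k) := con 2 :* (con 1 :+ k)) refl l′ ⟩
  2 * suc l′             ≤⟨ *-monoʳ-≤ 2 (m≤m*n (suc l′) (suc l′ ^ 1) {{m^n≢0 (suc l′) 1}}) ⟩
  2 * suc l′ ^ 2         ∎
  where
  open ≤-Reasoning
  open +-*-Solver

-- The value written for a window.

module Reply {R : ℕ} (h K l′ : ℕ) (l′<K : l′ < K)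
  (xs ys : List (Value R)) (|xs|≡h : length xs ≡ h) (i : ℕ) (fits : K ≤ length (drop i (xs ++ ys))) where

  open Windows {R} h K l′ l′<K

  private
    W = take K (drop i (xs ++ ys))
    m = suc (l′ + l′)

    crossed? : ℕ → Bool
    crossed? j = rank (rightStat ys j i) ≤ᵇ rank (leftStat xs j i)

    finite : orderStat l′ W < suc R
    finite = orderStat-finite l′ W (subst (l′ <_)
      (sym (trans (length-take K (drop i (xs ++ ys))) (m≤n⇒m⊓n≡m fits))) l′<K)

    -- The window has K > l′ elements, so its order statistic is finite and `x` is not `nothing`;
    -- the default `zero` is never read.
    exact : ∀ x → rank x ≡ orderStat l′ W → just (fromMaybe zero x) ≡ lthSmallest (suc l′) W
    exact x eq = trans (just-fromMaybe x (subst (_< suc R) (sym eq) finite)) (rank-injective x _ eq)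

  reply-correct : ∀ (p₁ p₂ : Party (Value R)) → Party.stat p₁ ≡ leftStat xs → Party.stat p₂ ≡ rightStat ys →
                  let c = prefix crossed? m in
                  just (fromMaybe zero (Party.stat (alternate p₁ p₂ c) c i)) ≡ lthSmallest (suc l′) W
  reply-correct p₁ p₂ refl refl
    with prefix crossed? m | prefix≤ crossed? m | (λ {u} → <prefix⇒T crossed? m {u}) | prefix<⇒¬T crossed? m
  ... | c | c≤m | passed | stopped with evenOrOdd c
  ...   | q , inj₁ refl
    rewrite sym (+-identityʳ (q + q)) | alternate-double+ p₁ p₂ q 0 | +-identityʳ (q + q) =
    exact (leftStat xs (q + q) i) (stat-even xs ys |xs|≡h i q q≤l′
      (λ j eq → ≤ᵇ⇒≤ _ _ (passed (≤-reflexive (sym eq))))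
      -- An even c differs from the odd m, so the run ended at a genuine failure.
      (λ cr → stopped (s≤s (+-mono-≤ q≤l′ q≤l′)) (≤⇒≤ᵇ cr)))
    where q≤l′ = halve-≤ q l′ c≤m
  ...   | q , inj₂ refl
    rewrite +-comm 1 (q + q) | alternate-double+ p₁ p₂ q 1 | +-comm (q + q) 1 =
    exact (rightStat ys (suc (q + q)) i) (stat-odd xs ys |xs|≡h i q (halve-≤ q l′ (<⇒≤ c≤m))
      (≤ᵇ⇒≤ _ _ (passed ≤-refl))
      (λ q<l′ cr → stopped (s≤s (≤-trans (n<1+n (q + q)) (≤-trans (≤-reflexive (sym (+-suc q q))) (+-mono-≤ (<⇒≤ q<l′) q<l′)))) (≤⇒≤ᵇ cr)))

-- Choice of the parameters and conclusion.

theorem4p13 : ∃[ C ] ∃[ d ]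
    ((l p : ℕ) → 1 ≤ l → 2 * l + 2 ≤ p →
    (N K R : ℕ) → l ≤ K → K ≤ N →
    Σ[ P ∈ Protocol (Value R) ]
    (SolvesInSingleOutputPass P p l N K ×
    ((A : Vec (Value R) N) →
    cost P p A ≤ (C * polylog d N R * (p * l ^ 2)) · N ^1/ (p ∸ 2 * l ∸ 1))))
theorem4p13 = 8 , 1 , solution
  where
  solution : (l p : ℕ) → 1 ≤ l → 2 * l + 2 ≤ p →
    (N K R : ℕ) → l ≤ K → K ≤ N →
    Σ[ P ∈ Protocol (Value R) ]
    (SolvesInSingleOutputPass P p l N K ×
    ((A : Vec (Value R) N) →
    cost P p A ≤ (8 * polylog 1 N R * (p * l ^ 2)) · N ^1/ (p ∸ 2 * l ∸ 1)))
  solution l@(suc l′) p 1≤l 2l+2≤p N K R l≤K K≤N = P , solves , λ A → subst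
      (λ c → c ^ r ≤ (8 * w * (p * l ^ 2)) ^ r * N)
      (sym (total-length (leftStat (left A)) (rightStat (right A)) p))
      (bound p l s m w r N 1≤s (1+2k≤2*[1+k]^2 l′) s^r≤)
    where
    r = p ∸ 2 * l ∸ 1
    w = polylog 1 N R
    h = ⌊ N /2⌋
    m = suc (l′ + l′)
    n = suc (N ∸ K)
    -- Alice moves at even turns, so writing starts at t + t, the least even number that is at least
    -- r.
    t = ⌈ r /2⌉

    2≤ : 2 ≤ p ∸ 2 * l
    2≤ = m+n≤o⇒m≤o∸n 2 (subst (_≤ p) (+-comm (2 * l) 2) 2l+2≤p)

    1≤r : 1 ≤ r
    1≤r = ∸-monoˡ-≤ 1 2≤

    p≡ : p ≡ 2 * l + suc r
    p≡ = begin
      p                        ≡⟨ m+[n∸m]≡n (≤-trans (m≤m+n (2 * l) 2) 2l+2≤p) ⟨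
      2 * l + (p ∸ 2 * l)      ≡⟨ cong (2 * l +_) (m+[n∸m]≡n (<⇒≤ 2≤)) ⟨
      2 * l + suc r            ∎
      where open ≡-Reasoning

    1≤N : 1 ≤ N
    1≤N = ≤-trans 1≤l (≤-trans l≤K K≤N)

    h<N : h < N
    h<N = subst (λ k → ⌊ k /2⌋ < k) (m+[n∸m]≡n 1≤N) (⌊n/2⌋<n (N ∸ 1))

    root = approxRoot r N {{>-nonZero 1≤r}} {{>-nonZero 1≤N}}
    s = proj₁ root
    1≤s = proj₁ (proj₂ root)
    N≤s^r = proj₁ (proj₂ (proj₂ root))
    s^r≤ = proj₂ (proj₂ (proj₂ root))

    open Windows {R} h K l′ l≤K
    open ThresholdSearch {R} m s w r n (t + t)
    open Correct using (total-length; output-correct)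

    left right : Vec (Value R) N → List (Value R)
    left A  = take h (toList A)
    right A = drop h (toList A)

    P : Protocol (Value R)
    P = record
      { alice = λ xs → takeTurn (aliceParty (leftStat xs))
      ; bob   = λ ys → takeTurn (bobParty (rightStat ys))
      }

    r≤t+t : r ≤ t + t
    r≤t+t = ≤-trans (≤-reflexive (sym (⌊n/2⌋+⌈n/2⌉≡n r))) (+-monoˡ-≤ t (⌊n/2⌋≤⌈n/2⌉ r))

    t+t≤1+r : t + t ≤ suc r
    t+t≤1+r = ≤-trans (+-monoʳ-≤ t (⌊n/2⌋≤⌈n/2⌉ (suc r))) (≤-reflexive (⌊n/2⌋+⌈n/2⌉≡n (suc r)))

    -- The last block falls at turn (r + 1) + (2l - 1) = p - 1 at the latest.
    t+t+m<p : t + t + m < p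
    t+t+m<p = begin-strict
      t + t + m        ≤⟨ +-monoˡ-≤ m t+t≤1+r ⟩
      suc r + m        <⟨ +-monoʳ-< (suc r) (≤-reflexive (solve 1 (λ k → con 2 :+ (k :+ k) := con 2 :* (con 1 :+ k)) refl l′)) ⟩
      suc r + 2 * l    ≡⟨ +-comm (suc r) (2 * l) ⟩
      2 * l + suc r    ≡⟨ p≡ ⟨
      p                ∎
      where
      open ≤-Reasoning
      open +-*-Solver

    solves : SolvesInSingleOutputPass P p l N K
    solves A = output-correct (leftStat xs) (rightStat ys) {h = h} {{>-nonZero 1≤s}}
      (λ j i≤i′ Pi → ≤⇒≤ᵇ (crossed-mono xs ys |xs|≡h j i≤i′ (≤ᵇ⇒≤ _ _ Pi)))
      (λ j h≤i → ≤⇒≤ᵇ (crossed-beyond xs ys |xs|≡h j h≤i))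
      (<-≤-trans h<N N≤s^r)
      (≤-trans (<⇒≤ (s≤s h<N)) (≤-trans (n≤1+n (suc N)) (2+N≤2^polylog N R)))
      (2+R≤2^polylog N R)
      t p refl r≤t+t t+t+m<p (λ i → lthSmallest l (window A K i)) reply
      where
      xs = left A
      ys = right A
      |xs|≡h : length xs ≡ h
      |xs|≡h = trans (length-take h (toList A)) (m≤n⇒m⊓n≡m
        (≤-trans (<⇒≤ h<N) (≤-reflexive (sym (length-toList A)))))
      joined : xs ++ ys ≡ toList A
      joined = take++drop≡id h (toList A)
      fits : ∀ {i} → i < n → K ≤ length (drop i (xs ++ ys))
      fits {i} (s≤s i≤) rewrite joined | length-drop i (toList A) | length-toList A =
        ≤-trans (≤-reflexive (sym (m∸[m∸n]≡n K≤N))) (∸-monoʳ-≤ N i≤)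
      reply : ∀ {i} → i < n → _
      reply {i} i<n = trans
        (Reply.reply-correct h K l′ l≤K xs ys |xs|≡h i (fits i<n) (aliceParty (leftStat xs)) (bobParty (rightStat ys)) refl refl)
        (cong (λ zs → lthSmallest l (take K (drop i zs))) joined)
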